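{- Let $\chi\in\{\pm1\}^{\binom{[n]}{k}}$ be a uniform realizable chirotope, and fix $L\in\binom{[n]}{k-2}$ and $\{a,b,c,d\}\in\binom{[n]}{4}$ with $L\cap\{a,b,c,d\}=\emptyset$. Consider the three terms $T_1=p_{Lab}p_{Lcd}$, $T_2=p_{Lac}p_{Lbd}$, $T_3=p_{Lad}p_{Lbc}$ of the corresponding three-term Plücker relation $f$. Then, among the three 2-splits of the octahedral face $F_{L;\{a,b,c,d\}}$ of the hypersimplex $\Delta_{k,n}$ (equivalently, among the three pairs $\{T_i,T_j\}$, $i\neq j$, at which the minimum of the tropicalization of $f$ may be attained with the third term strictly larger), exactly two are compatible with $\chi$, i.e. exactly two of the pairs $\{T_i,T_j\}$ consist of one term of $f^\chi_+$ and one term of $f^\chi_-$.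
   Context: A uniform realizable chirotope is $\chi\in\{\pm1\}^{\binom{[n]}{k}}$ with $\chi_I=\operatorname{sign}p_I(g)$ for all $I$ (sorted increasingly) for some real $k\times n$ matrix $g$ with all maximal minors nonzero. For the three-term Plücker relation $f$ (the standard Grassmann–Plücker relation among the terms $T_1,T_2,T_3$ with coefficients $\pm1$, where $p_{LS}$ is the Plücker coordinate indexed by $L\cup S$), $f^\chi_+$ (resp. $f^\chi_-$) is the sum of the terms of $f$ (with their coefficients) whose evaluation at $p=\chi$ is positive (resp. negative). The hypersimplex is $\Delta_{k,n}=\{x\in[0,1]^n:\sum x_j=k\}$; its face $F_{L;\{a,b,c,d\}}$ given by $x_\ell=1$ for $\ell\in L$ and $x_a+x_b+x_c+x_d=2$ is an octahedron with vertices indexed by $Lab,Lac,Lad,Lbc,Lbd,Lcd$; a vector $\pi\in\mathbb{R}^{\binom{n}{k}}$ induces a 2-split of this octahedron exactly when the minimum of $\pi_{Lab}+\pi_{Lcd},\pi_{Lac}+\pi_{Lbd},\pi_{Lad}+\pi_{Lbc}$ is attained exactly twice, and the split is determined by which two of the three sums attain the minimum. A split is compatible with $\chi$ if the vectors inducing it satisfy $\mathrm{Trop}(f^\chi_+)(\pi)=\mathrm{Trop}(f^\chi_-)(\pi)$, where $\mathrm{Trop}(h)(\pi)$ is the minimum of $\alpha\cdot\pi$ over exponent vectors $\alpha$ of monomials of $h$.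
   Formalization: The chirotope χ is realized by a $g$ with rational entries rather than a real k×n matrix, and the vectors π in the definition of compatibility take values in ℚ instead of ℝ. -}

module Defs where

open import Data.Nat using (ℕ; zero; suc)
open import Data.Fin using (Fin; zero; suc; punchIn; toℕ)
open import Data.Fin.Subset using (Subset; _∪_; ⁅_⁆; inside; outside)
open import Data.Vec using ([]; _∷_)
open import Data.List using (List; []; _∷_; map)
open import Data.Maybe using (Maybe; just; nothing; maybe)
open import Data.Bool using (true; false)
open import Data.Rational using (ℚ; 0ℚ; 1ℚ; -_; _+_; _*_; _<_; _⊓_)
open import Data.Sign using (Sign) renaming (_*_ to _·_)
open import Data.Product using (_×_; Σ)
open import Relation.Binary.PropositionalEquality using (_≡_)
open import Relation.Nullary using (¬_)

------------------------------------------------------------------------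
-- Linear algebra over ℚ

-- Sum over Fin m.
sumFin : (m : ℕ) → (Fin m → ℚ) → ℚ
sumFin zero    f = 0ℚ
sumFin (suc m) f = f zero + sumFin m (λ i → f (suc i))

-- (-1)^j
altSign : ℕ → ℚ
altSign zero          = 1ℚ
altSign (suc zero)    = - 1ℚ
altSign (suc (suc j)) = altSign j

-- Determinant of an m×m matrix (M row col), Laplace expansion along row 0.
det : (m : ℕ) → (Fin m → Fin m → ℚ) → ℚ
det zero    M = 1ℚ
det (suc m) M =
  sumFin (suc m) (λ j → altSign (toℕ j) * (M zero j *
    det m (λ r c → M (suc r) (punchIn j c))))

------------------------------------------------------------------------
-- Subsets of [n] and Plücker coordinates

-- Elements of a subset, listed in increasing order.
elems : ∀ {n} → Subset n → List (Fin n)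
elems []            = []
elems (true  ∷ xs)  = zero ∷ map suc (elems xs)
elems (false ∷ xs)  = map suc (elems xs)

nth : ∀ {A : Set} → List A → ℕ → Maybe A
nth []       _       = nothing
nth (x ∷ xs) zero    = just x
nth (x ∷ xs) (suc j) = nth xs j

-- The k×k submatrix of g (a k×n matrix) on the columns of I, taken in
-- increasing order (only meaningful when |I| = k).
subMatrix : ∀ {k n} → (Fin k → Fin n → ℚ) → Subset n → Fin k → Fin k → ℚ
subMatrix g I r j = maybe (g r) 0ℚ (nth (elems I) (toℕ j))

-- Plücker coordinate p_I(g).
plucker : ∀ {k n} → (Fin k → Fin n → ℚ) → Subset n → ℚ
plucker {k} g I = det k (subMatrix g I)

-- sign x ≡ s  (with x ≠ 0)
HasSign : Sign → ℚ → Set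
HasSign Sign.+ x = 0ℚ < x
HasSign Sign.- x = x < 0ℚ

-- A chirotope on k-subsets of [n]: a sign for every subset (only values
-- on subsets of cardinality k matter).
Chirotope : ℕ → Set
Chirotope n = Subset n → Sign

-- Uniform realizable chirotope (realization over ℚ, see NOTES.md).
UniformRealizable : (k n : ℕ) → Chirotope n → Set
UniformRealizable k n χ =
  Σ (Fin k → Fin n → ℚ) λ g →
    ∀ (I : Subset n) → Data.Fin.Subset.∣ I ∣ ≡ k → HasSign (χ I) (plucker g I)

------------------------------------------------------------------------
-- The three-term Plücker relation f = T₁ − T₂ + T₃ with
-- T₁ = p_Lab p_Lcd, T₂ = p_Lac p_Lbd, T₃ = p_Lad p_Lbc   (a<b<c<d)

_∪₂_ : ∀ {n} → Subset n → Fin n × Fin n → Subset n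
L ∪₂ (x Data.Product., y) = (L ∪ ⁅ x ⁆) ∪ ⁅ y ⁆

module ThreeTerm {n : ℕ} (L : Subset n) (a b c d : Fin n) where
  open Data.Product using (_,_)

  -- the two index sets of the monomial of term t
  termSets : Fin 3 → Subset n × Subset n
  termSets zero                = (L ∪₂ (a , b)) , (L ∪₂ (c , d))
  termSets (suc zero)          = (L ∪₂ (a , c)) , (L ∪₂ (b , d))
  termSets (suc (suc zero))    = (L ∪₂ (a , d)) , (L ∪₂ (b , c))

  -- coefficient of term t in f
  coeff : Fin 3 → Sign
  coeff zero             = Sign.+
  coeff (suc zero)       = Sign.-
  coeff (suc (suc zero)) = Sign.+

  -- sign of (coefficient · T_t) evaluated at p = χ
  termSign : Chirotope n → Fin 3 → Sign
  termSign χ t = coeff t · (χ (Data.Product.proj₁ (termSets t))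
                          · χ (Data.Product.proj₂ (termSets t)))

  -- α · π for the exponent vector α of the monomial of term t
  weight : (Subset n → ℚ) → Fin 3 → ℚ
  weight π t = π (Data.Product.proj₁ (termSets t)) + π (Data.Product.proj₂ (termSets t))

  -- min with nothing = +∞
  minM : Maybe ℚ → Maybe ℚ → Maybe ℚ
  minM nothing  y        = y
  minM (just x) nothing  = just x
  minM (just x) (just y) = just (x ⊓ y)

  contrib : Chirotope n → Sign → (Subset n → ℚ) → Fin 3 → Maybe ℚ
  contrib χ s π t with termSign χ t Data.Sign.≟ s
  ... | Relation.Nullary.yes _ = just (weight π t)
  ... | Relation.Nullary.no  _ = nothing

  -- Trop(f^χ_s)(π) : minimum of α·π over the terms of f^χ_s (nothing = +∞,
  -- the tropicalization of the zero polynomial)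
  tropPart : Chirotope n → Sign → (Subset n → ℚ) → Maybe ℚ
  tropPart χ s π =
    minM (contrib χ s π zero) (minM (contrib χ s π (suc zero)) (contrib χ s π (suc (suc zero))))

  -- π induces the 2-split of the octahedron F_{L;{a,b,c,d}} in which the
  -- minimum of the three sums is attained exactly at the two terms other than s
  InducesSplit : Fin 3 → (Subset n → ℚ) → Set
  InducesSplit s π =
    Σ (Fin 3) λ i → Σ (Fin 3) λ j →
      ¬ i ≡ j × ¬ i ≡ s × ¬ j ≡ s ×
      weight π i ≡ weight π j × weight π i < weight π s

  -- the split (labelled by the term s not attaining the minimum) is
  -- compatible with χ
  Compatible : Chirotope n → Fin 3 → Set
  Compatible χ s = ∀ (π : Subset n → ℚ) → InducesSplit s π →
    tropPart χ Sign.+ π ≡ tropPart χ Sign.- π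

  -- exactly two of the three splits are compatible with χ
  ExactlyTwoCompatible : Chirotope n → Set
  ExactlyTwoCompatible χ =
    Σ (Fin 3) λ s → ¬ Compatible χ s × (∀ t → ¬ t ≡ s → Compatible χ t)

-- Let g realize χ. Its maximal minors satisfy p_Lab p_Lcd − p_Lac p_Lbd + p_Lad p_Lbc = 0: for determinants this
-- is the linear form det (_ ∷ a ∷ ℓ) applied to the cofactor relation among b, c, d and the rows ℓ of L, and moving
-- columns x < y to the front of the sorted columns of L ∪ {x, y} costs a sign (−1)^(#{l ∈ L | l < x} + #{l ∈ L | l < y})
-- that occurs in all three terms alike. Hence the three terms of f evaluated at p = χ do not all have the same sign,
-- and exactly one of them, T_s, is the odd one out. If T_i and T_j are minimal and the third term is strictly larger,
-- then Trop(f⁺) = Trop(f⁻) exactly when T_i and T_j have opposite signs, i.e. when s ∈ {i, j}. So the two splits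
-- whose minimal pair contains T_s are compatible, while the remaining one is not, as witnessed by the weight
-- X ↦ [a ∈ X ∧ p ∈ X] with p the partner of a in T_s.

module Submission where

open import Defs

-- Kept in a module so that ℚ's _+_ is out of scope in the statement of lemma3p5, which uses ℕ's.
module ThreeTermRelation where

  open import Algebra.Bundles using (CommutativeRing)
  open import Data.Bool using (_∧_; if_then_else_)
  open import Data.Bool.Properties using (∧-zeroʳ)
  open import Data.Empty using (⊥-elim)
  open import Data.Fin using (Fin; zero; suc; punchIn; toℕ; _<_)
  import Data.Fin.Properties as Fin
  open import Data.Fin.Subset using (Subset; _∪_; ⁅_⁆; _∈_; _∉_; ∣_∣; inside; outside)
  open import Data.Fin.Subset.Properties using (∪-identityʳ; x∈p∪q⁺; x∈p∪q⁻; x∈⁅x⁆; x∈⁅y⁆⇒x≡y; _∈?_)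
  open import Data.List using (List; []; _∷_; _++_; [_]; map; length)
  open import Data.List.Properties using (map-++; length-map; ++-assoc; length-++-sucʳ)
  import Data.List.Relation.Binary.Permutation.Propositional as ↭
  open import Data.List.Relation.Binary.Permutation.Propositional.Properties using (↭-length; ++⁺ˡ)
  open import Data.Maybe using (Maybe; just; nothing; maybe)
  open import Data.Maybe.Properties using (just-injective)
  open import Data.Nat using (ℕ; zero; suc; s≤s)
  import Data.Nat.Properties as ℕ
  open import Data.Product using (Σ; ∃₂; _×_; _,_; proj₁; proj₂)
  open import Data.Rational using (ℚ; 0ℚ; 1ℚ; ½; -_; _+_; _*_; _⊓_; positive; negative) renaming (_<_ to _<ℚ_)
  import Data.Rational.Properties as ℚ
  open import Data.Rational.Solver using (module +-*-Solver)
  open import Data.Sign using (Sign; opposite) renaming (_*_ to _·_; _≟_ to _≟ˢ_)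
  open import Data.Sum using (inj₁; inj₂)
  open import Data.Vec using ([]; _∷_; here; there)
  open import Data.Vec.Functional using (Vector) renaming (_∷_ to _∷ᶠ_)
  open import Function using (_∘_; const; _⇔_; mk⇔; Equivalence)
  open import Relation.Binary.PropositionalEquality
    using (_≡_; _≢_; refl; sym; trans; subst; subst₂; cong; cong₂; module ≡-Reasoning)
  open import Relation.Nullary using (¬_; yes; no; does)
  open import Relation.Nullary.Decidable using (dec-true; dec-false)

  open import Algebra.Properties.Semiring.Sum (CommutativeRing.semiring ℚ.+-*-commutativeRing)
    using (sum; sum-syntax; sum-cong-≗; sum-replicate-zero; ∑-comm; *-distribˡ-sum; *-distribʳ-sum)
  open import Algebra.Properties.Ring (CommutativeRing.ring ℚ.+-*-commutativeRing)
    using (-‿involutive; -1*x≈-x)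
  open +-*-Solver

  Matrix : ℕ → Set
  Matrix m = Fin m → Fin m → ℚ

  minor : ∀ {m} → Matrix (suc m) → Fin (suc m) → Fin (suc m) → Matrix m
  minor M i j r c = M (punchIn i r) (punchIn j c)

  laplaceTerm : ∀ {m} → Matrix (suc m) → Fin (suc m) → ℚ
  laplaceTerm {m} M j = altSign (toℕ j) * (M zero j * det m (minor M zero j))

  sumFin≡sum : ∀ m (f : Vector ℚ m) → sumFin m f ≡ sum f
  sumFin≡sum zero    f = refl
  sumFin≡sum (suc m) f = cong (f zero +_) (sumFin≡sum m (f ∘ suc))

  det-expand : ∀ m (M : Matrix (suc m)) → det (suc m) M ≡ sum (laplaceTerm M)
  det-expand m M = sumFin≡sum (suc m) (laplaceTerm M)

  neg-sum : ∀ {m} (f : Vector ℚ m) → - sum f ≡ sum (λ i → - f i)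
  neg-sum f = begin
    - sum f                   ≡⟨ -1*x≈-x (sum f) ⟨
    - 1ℚ * sum f              ≡⟨ *-distribˡ-sum (- 1ℚ) f ⟩
    sum (λ i → - 1ℚ * f i)    ≡⟨ sum-cong-≗ (λ i → -1*x≈-x (f i)) ⟩
    sum (λ i → - f i)         ∎
    where open ≡-Reasoning

  altSign-suc : ∀ n → altSign (suc n) ≡ - altSign n
  altSign-suc zero          = refl
  altSign-suc (suc n) = begin
    altSign n           ≡⟨ -‿involutive (altSign n) ⟨
    - - altSign n       ≡⟨ cong -_ (sym (altSign-suc n)) ⟩
    - altSign (suc n)   ∎
    where open ≡-Reasoning

  det-cong : ∀ m {M N : Matrix m} → (∀ r c → M r c ≡ N r c) → det m M ≡ det m N
  det-cong zero    M≗N = refl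
  det-cong (suc m) {M} {N} M≗N = begin
    det (suc m) M         ≡⟨ det-expand m M ⟩
    sum (laplaceTerm M)   ≡⟨ sum-cong-≗ (λ j → cong₂ (λ x y → altSign (toℕ j) * (x * y))
                               (M≗N zero j) (det-cong m (λ r c → M≗N (suc r) (punchIn j c)))) ⟩
    sum (laplaceTerm N)   ≡⟨ det-expand m N ⟨
    det (suc m) N         ∎
    where open ≡-Reasoning

  swap₀₁ : ∀ {m} → Fin (suc (suc m)) → Fin (suc (suc m))
  swap₀₁ zero          = suc zero
  swap₀₁ (suc zero)    = zero
  swap₀₁ (suc (suc i)) = suc (suc i)

  swap₀₁-suc : ∀ {m} (c : Fin (suc m)) → swap₀₁ (suc c) ≡ punchIn (suc zero) c
  swap₀₁-suc zero    = refl
  swap₀₁-suc (suc c) = refl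

  swap₀₁-punchIn₁ : ∀ {m} (c : Fin (suc m)) → swap₀₁ (punchIn (suc zero) c) ≡ suc c
  swap₀₁-punchIn₁ zero    = refl
  swap₀₁-punchIn₁ (suc c) = refl

  swap₀₁-punchIn₂₊ : ∀ {m} (i : Fin (suc m)) (c : Fin (suc (suc m))) →
    swap₀₁ (punchIn (suc (suc i)) c) ≡ punchIn (suc (suc i)) (swap₀₁ c)
  swap₀₁-punchIn₂₊ i zero          = refl
  swap₀₁-punchIn₂₊ i (suc zero)    = refl
  swap₀₁-punchIn₂₊ i (suc (suc c)) = refl

  swapCols₀₁ : ∀ {m} → Matrix (suc (suc m)) → Matrix (suc (suc m))
  swapCols₀₁ M r c = M r (swap₀₁ c)

  det-swapCols₀₁ : ∀ m (M : Matrix (suc (suc m))) → det (suc (suc m)) (swapCols₀₁ M) ≡ - det (suc (suc m)) M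
  det-swapCols₀₁ m M = begin
    det _ (swapCols₀₁ M)
      ≡⟨ det-expand _ (swapCols₀₁ M) ⟩
    1ℚ * (M zero (suc zero) * det _ (minor (swapCols₀₁ M) zero zero))
      + ((- 1ℚ) * (M zero zero * det _ (minor (swapCols₀₁ M) zero (suc zero))) + sum (later (swapCols₀₁ M)))
      ≡⟨ cong₂ (λ x y → 1ℚ * (M zero (suc zero) * x) + ((- 1ℚ) * (M zero zero * y) + sum (later (swapCols₀₁ M))))
           (det-cong _ (λ r c → cong (M (suc r)) (swap₀₁-suc c)))
           (det-cong _ (λ r c → cong (M (suc r)) (swap₀₁-punchIn₁ c))) ⟩
    1ℚ * (M zero (suc zero) * D₁) + ((- 1ℚ) * (M zero zero * D₀) + sum (later (swapCols₀₁ M)))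
      ≡⟨ cong (λ x → 1ℚ * (M zero (suc zero) * D₁) + ((- 1ℚ) * (M zero zero * D₀) + x)) (later-swap m M) ⟩
    1ℚ * (M zero (suc zero) * D₁) + ((- 1ℚ) * (M zero zero * D₀) + - sum (later M))
      ≡⟨ solve 5 (λ a b c d e → con 1ℚ :* (a :* b) :+ (con (- 1ℚ) :* (c :* d) :+ :- e)
                   := :- (con 1ℚ :* (c :* d) :+ (con (- 1ℚ) :* (a :* b) :+ e)))
           refl (M zero (suc zero)) D₁ (M zero zero) D₀ (sum (later M)) ⟩
    - sum (laplaceTerm M)
      ≡⟨ cong -_ (sym (det-expand _ M)) ⟩
    - det _ M ∎
    where
    open ≡-Reasoning
    D₀ = det (suc m) (minor M zero zero)
    D₁ = det (suc m) (minor M zero (suc zero))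
    later : ∀ {m} → Matrix (suc (suc m)) → Vector ℚ m
    later M i = laplaceTerm M (suc (suc i))
    later-swap : ∀ m (M : Matrix (suc (suc m))) → sum (later (swapCols₀₁ M)) ≡ - sum (later M)
    later-swap zero    M = refl
    later-swap (suc m) M = begin
      sum (later (swapCols₀₁ M))         ≡⟨ sum-cong-≗ (λ i → cong (λ x → altSign (toℕ i) * (M zero (suc (suc i)) * x))
                                            (det-swapped-minor i)) ⟩
      sum (λ i → altSign (toℕ i) * (M zero (suc (suc i)) * - det _ (minor M zero (suc (suc i)))))
        ≡⟨ sum-cong-≗ (λ i → solve 3 (λ s a d → s :* (a :* :- d) := :- (s :* (a :* d))) refl
                                (altSign (toℕ i)) (M zero (suc (suc i))) (det _ (minor M zero (suc (suc i))))) ⟩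
      sum (λ i → - later M i)            ≡⟨ sym (neg-sum (later M)) ⟩
      - sum (later M)                    ∎
      where
      det-swapped-minor : ∀ i → det _ (minor (swapCols₀₁ M) zero (suc (suc i))) ≡ - det _ (minor M zero (suc (suc i)))
      det-swapped-minor i = trans (det-cong _ (λ r c → cong (M (suc r)) (swap₀₁-punchIn₂₊ i c)))
                                  (det-swapCols₀₁ m (minor M zero (suc (suc i))))

  colTerm : ∀ {m} → Matrix (suc m) → Fin (suc m) → ℚ
  colTerm {m} M r = altSign (toℕ r) * (M r zero * det m (minor M r zero))

  *-distribˡ-sum₂ : ∀ {m} x y (f : Vector ℚ m) → x * (y * sum f) ≡ sum (λ i → x * (y * f i))
  *-distribˡ-sum₂ x y f = trans (cong (x *_) (*-distribˡ-sum y f)) (*-distribˡ-sum x (λ i → y * f i))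

  det-expandCol : ∀ m (M : Matrix (suc m)) → det (suc m) M ≡ sum (colTerm M)
  det-expandCol zero    M = refl
  det-expandCol (suc m) M = trans (det-expand (suc m) M) (cong (laplaceTerm M zero +_) later)
    where
    open ≡-Reasoning
    E : Fin (suc m) → Fin (suc m) → ℚ
    E j r = det m (minor (minor M zero (suc j)) r zero)
    F : Fin (suc m) → Fin (suc m) → ℚ
    F j r = altSign (toℕ (suc j)) * (M zero (suc j) * (altSign (toℕ r) * (M (suc r) zero * E j r)))
    F-swap : ∀ j r → F j r ≡ altSign (toℕ (suc r)) * (M (suc r) zero * (altSign (toℕ j) * (M zero (suc j) * E j r)))
    F-swap j r = begin
      F j r
        ≡⟨ cong (λ s → s * (M zero (suc j) * (altSign (toℕ r) * (M (suc r) zero * E j r)))) (altSign-suc (toℕ j)) ⟩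
      (- altSign (toℕ j)) * (M zero (suc j) * (altSign (toℕ r) * (M (suc r) zero * E j r)))
        ≡⟨ solve 5 (λ sj sr a b e → (:- sj) :* (a :* (sr :* (b :* e))) := (:- sr) :* (b :* (sj :* (a :* e))))
             refl (altSign (toℕ j)) (altSign (toℕ r)) (M zero (suc j)) (M (suc r) zero) (E j r) ⟩
      (- altSign (toℕ r)) * (M (suc r) zero * (altSign (toℕ j) * (M zero (suc j) * E j r)))
        ≡⟨ cong (λ s → s * (M (suc r) zero * (altSign (toℕ j) * (M zero (suc j) * E j r)))) (sym (altSign-suc (toℕ r))) ⟩
      altSign (toℕ (suc r)) * (M (suc r) zero * (altSign (toℕ j) * (M zero (suc j) * E j r))) ∎
    later : sum (λ j → laplaceTerm M (suc j)) ≡ sum (λ r → colTerm M (suc r))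
    later = begin
      sum (λ j → laplaceTerm M (suc j))
        ≡⟨ sum-cong-≗ (λ j → trans (cong (λ x → altSign (toℕ (suc j)) * (M zero (suc j) * x))
                                         (det-expandCol m (minor M zero (suc j))))
                                   (*-distribˡ-sum₂ (altSign (toℕ (suc j))) (M zero (suc j))
                                      (λ r → altSign (toℕ r) * (M (suc r) zero * E j r)))) ⟩
      ∑[ j < suc m ] ∑[ r < suc m ] F j r
        ≡⟨ ∑-comm F ⟩
      ∑[ r < suc m ] ∑[ j < suc m ] F j r
        ≡⟨ sum-cong-≗ (λ r → trans (sum-cong-≗ (λ j → F-swap j r))
             (trans (sym (*-distribˡ-sum₂ (altSign (toℕ (suc r))) (M (suc r) zero)
                                          (λ j → altSign (toℕ j) * (M zero (suc j) * E j r))))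
                    (cong (λ x → altSign (toℕ (suc r)) * (M (suc r) zero * x))
                          (sym (det-expand m (minor M (suc r) zero)))))) ⟩
      sum (λ r → colTerm M (suc r)) ∎

  transpose : ∀ {m} → Matrix m → Matrix m
  transpose M r c = M c r

  det-transpose : ∀ m (M : Matrix m) → det m (transpose M) ≡ det m M
  det-transpose zero    M = refl
  det-transpose (suc m) M = begin
    det (suc m) (transpose M)     ≡⟨ det-expand m (transpose M) ⟩
    sum (laplaceTerm (transpose M)) ≡⟨ sum-cong-≗ (λ j → cong (λ x → altSign (toℕ j) * (M j zero * x))
                                        (det-transpose m (minor M j zero))) ⟩
    sum (colTerm M)               ≡⟨ sym (det-expandCol m M) ⟩
    det (suc m) M                 ∎
    where open ≡-Reasoning

  swapRows₀₁ : ∀ {m} → Matrix (suc (suc m)) → Matrix (suc (suc m))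
  swapRows₀₁ M r = M (swap₀₁ r)

  det-swapRows₀₁ : ∀ m (M : Matrix (suc (suc m))) → det (suc (suc m)) (swapRows₀₁ M) ≡ - det (suc (suc m)) M
  det-swapRows₀₁ m M = begin
    det _ (swapRows₀₁ M)                       ≡⟨ sym (det-transpose _ (swapRows₀₁ M)) ⟩
    det _ (swapCols₀₁ (transpose M))           ≡⟨ det-swapCols₀₁ m (transpose M) ⟩
    - det _ (transpose M)                      ≡⟨ cong -_ (det-transpose _ M) ⟩
    - det _ M                                  ∎
    where open ≡-Reasoning

  det-∷-swap : ∀ m (x y : Vector ℚ (suc (suc m))) (N : Fin m → Vector ℚ (suc (suc m))) →
    det (suc (suc m)) (x ∷ᶠ y ∷ᶠ N) ≡ - det (suc (suc m)) (y ∷ᶠ x ∷ᶠ N)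
  det-∷-swap m x y N = trans (det-cong _ swapped) (det-swapRows₀₁ m (y ∷ᶠ x ∷ᶠ N))
    where
    swapped : ∀ r c → (x ∷ᶠ y ∷ᶠ N) r c ≡ swapRows₀₁ (y ∷ᶠ x ∷ᶠ N) r c
    swapped zero          c = refl
    swapped (suc zero)    c = refl
    swapped (suc (suc r)) c = refl

  laplaceTerms≡0⇒det≡0 : ∀ m (M : Matrix (suc m)) → (∀ j → laplaceTerm M j ≡ 0ℚ) → det (suc m) M ≡ 0ℚ
  laplaceTerms≡0⇒det≡0 m M terms≡0 =
    trans (det-expand m M) (trans (sum-cong-≗ terms≡0) (sum-replicate-zero (suc m)))

  det-zeroRow₀ : ∀ m (N : Fin m → Vector ℚ (suc m)) → det (suc m) ((λ _ → 0ℚ) ∷ᶠ N) ≡ 0ℚ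
  det-zeroRow₀ m N = laplaceTerms≡0⇒det≡0 m ((λ _ → 0ℚ) ∷ᶠ N) λ j →
    solve 2 (λ s d → s :* (con 0ℚ :* d) := con 0ℚ) refl (altSign (toℕ j)) (det m (λ r c → N r (punchIn j c)))

  x≡-x⇒x≡0 : ∀ {x : ℚ} → x ≡ - x → x ≡ 0ℚ
  x≡-x⇒x≡0 {x} x≡-x = begin
    x               ≡⟨ solve 1 (λ x → x := con ½ :* (x :+ x)) refl x ⟩
    ½ * (x + x)     ≡⟨ cong (λ y → ½ * (x + y)) x≡-x ⟩
    ½ * (x + - x)   ≡⟨ solve 1 (λ x → con ½ :* (x :+ :- x) := con 0ℚ) refl x ⟩
    0ℚ              ∎
    where open ≡-Reasoning

  det-equalRows₀ : ∀ m (M : Matrix (suc m)) (j : Fin m) → (∀ c → M zero c ≡ M (suc j) c) → det (suc m) M ≡ 0ℚ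
  det-equalRows₀ (suc m) M zero    eq = x≡-x⇒x≡0 (trans (det-cong _ M≗swapped) (det-swapRows₀₁ m M))
    where
    M≗swapped : ∀ r c → M r c ≡ swapRows₀₁ M r c
    M≗swapped zero          c = eq c
    M≗swapped (suc zero)    c = sym (eq c)
    M≗swapped (suc (suc r)) c = refl
  det-equalRows₀ (suc m) M (suc j) eq = begin
    det _ M                   ≡⟨ -‿involutive (det _ M) ⟨
    - - det _ M               ≡⟨ cong -_ (det-swapRows₀₁ m M) ⟨
    - det _ (swapRows₀₁ M)    ≡⟨ cong -_ (laplaceTerms≡0⇒det≡0 (suc m) (swapRows₀₁ M) λ k →
                                  trans (cong (λ x → altSign (toℕ k) * (M (suc zero) k * x))
                                              (det-equalRows₀ m (minor (swapRows₀₁ M) zero k) j (λ c → eq (punchIn k c))))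
                                        (solve 2 (λ s x → s :* (x :* con 0ℚ) := con 0ℚ) refl (altSign (toℕ k)) (M (suc zero) k))) ⟩
    - 0ℚ                      ≡⟨⟩
    0ℚ                        ∎
    where open ≡-Reasoning

  det-linear₀ : ∀ m p (α : Vector ℚ p) (w : Fin p → Vector ℚ (suc m)) (N : Fin m → Vector ℚ (suc m)) →
    det (suc m) ((λ c → ∑[ i < p ] (α i * w i c)) ∷ᶠ N) ≡ ∑[ i < p ] (α i * det (suc m) (w i ∷ᶠ N))
  det-linear₀ m p α w N = begin
    det (suc m) ((λ c → ∑[ i < p ] (α i * w i c)) ∷ᶠ N)
      ≡⟨ det-expand m ((λ c → ∑[ i < p ] (α i * w i c)) ∷ᶠ N) ⟩
    ∑[ j < suc m ] (altSign (toℕ j) * ((∑[ i < p ] (α i * w i j)) * D j))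
      ≡⟨ sum-cong-≗ (λ j → trans (solve 3 (λ s x d → s :* (x :* d) := x :* (s :* d)) refl
                                     (altSign (toℕ j)) (∑[ i < p ] (α i * w i j)) (D j))
                                 (*-distribʳ-sum (altSign (toℕ j) * D j) (λ i → α i * w i j))) ⟩
    ∑[ j < suc m ] ∑[ i < p ] ((α i * w i j) * (altSign (toℕ j) * D j))
      ≡⟨ ∑-comm (λ j i → (α i * w i j) * (altSign (toℕ j) * D j)) ⟩
    ∑[ i < p ] ∑[ j < suc m ] ((α i * w i j) * (altSign (toℕ j) * D j))
      ≡⟨ sum-cong-≗ (λ i → trans (sum-cong-≗ (λ j → solve 4 (λ a x s d → (a :* x) :* (s :* d) := a :* (s :* (x :* d)))
                                                         refl (α i) (w i j) (altSign (toℕ j)) (D j)))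
                                 (sym (*-distribˡ-sum (α i) (laplaceTerm (w i ∷ᶠ N))))) ⟩
    ∑[ i < p ] (α i * sum (laplaceTerm (w i ∷ᶠ N)))
      ≡⟨ sum-cong-≗ (λ i → cong (α i *_) (det-expand m (w i ∷ᶠ N))) ⟨
    ∑[ i < p ] (α i * det (suc m) (w i ∷ᶠ N)) ∎
    where
    open ≡-Reasoning
    D : Fin (suc m) → ℚ
    D j = det m (λ r c → N r (punchIn j c))

  cofactor : ∀ {k} → (Fin (suc k) → Vector ℚ k) → Fin (suc k) → ℚ
  cofactor {k} W i = altSign (toℕ i) * det k (W ∘ punchIn i)

  -- Expand along column 0 a matrix whose column 0 repeats column c.
  cofactor-relation : ∀ k (W : Fin (suc k) → Vector ℚ k) (c : Fin k) → ∑[ i < suc k ] (cofactor W i * W i c) ≡ 0ℚ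
  cofactor-relation k W c = begin
    ∑[ i < suc k ] (cofactor W i * W i c)
      ≡⟨ sum-cong-≗ (λ i → solve 3 (λ s d w → (s :* d) :* w := s :* (w :* d)) refl
                                 (altSign (toℕ i)) (det k (W ∘ punchIn i)) (W i c)) ⟩
    sum (colTerm N)          ≡⟨ det-expandCol k N ⟨
    det (suc k) N            ≡⟨ det-transpose (suc k) N ⟨
    det (suc k) (transpose N) ≡⟨ det-equalRows₀ k (transpose N) c (λ _ → refl) ⟩
    0ℚ                       ∎
    where
    open ≡-Reasoning
    N : Matrix (suc k)
    N r = W r c ∷ᶠ W r

  -- Apply the linear form det (_ ∷ a ∷ ℓ), which vanishes on the rows of ℓ, to the cofactor relation of b, c, d, ℓ.
  det-plücker : ∀ m (ℓ : Fin m → Vector ℚ (suc (suc m))) (a b c d : Vector ℚ (suc (suc m))) →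
    det _ (a ∷ᶠ b ∷ᶠ ℓ) * det _ (c ∷ᶠ d ∷ᶠ ℓ)
      + (- (det _ (a ∷ᶠ c ∷ᶠ ℓ) * det _ (b ∷ᶠ d ∷ᶠ ℓ)) + det _ (a ∷ᶠ d ∷ᶠ ℓ) * det _ (b ∷ᶠ c ∷ᶠ ℓ)) ≡ 0ℚ
  det-plücker m ℓ a b c d = begin
    Δ a b * Δ c d + (- (Δ a c * Δ b d) + Δ a d * Δ b c)
      ≡⟨ solve 6 (λ ab cd ac bd ad bc → ab :* cd :+ (:- (ac :* bd) :+ ad :* bc)
                   := :- (con 1ℚ :* cd :* (:- ab) :+ ((:- bd) :* (:- ac) :+ (bc :* (:- ad) :+ con 0ℚ))))
           refl (Δ a b) (Δ c d) (Δ a c) (Δ b d) (Δ a d) (Δ b c) ⟩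
    - (1ℚ * Δ c d * (- Δ a b) + ((- Δ b d) * (- Δ a c) + (Δ b c * (- Δ a d) + 0ℚ)))
      ≡⟨ cong -_ expansion ⟨
    - (∑[ i < suc k ] (cofactor W i * φ (W i)))
      ≡⟨ cong -_ (det-linear₀ (suc m) (suc k) (cofactor W) W (a ∷ᶠ ℓ)) ⟨
    - φ (λ x → ∑[ i < suc k ] (cofactor W i * W i x))
      ≡⟨ cong -_ (det-cong k combination≡0) ⟩
    - φ (λ _ → 0ℚ)
      ≡⟨ cong -_ (det-zeroRow₀ (suc m) (a ∷ᶠ ℓ)) ⟩
    0ℚ ∎
    where
    open ≡-Reasoning
    k = suc (suc m)
    Δ : Vector ℚ k → Vector ℚ k → ℚ
    Δ x y = det k (x ∷ᶠ y ∷ᶠ ℓ)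
    W : Fin (suc k) → Vector ℚ k
    W = b ∷ᶠ c ∷ᶠ d ∷ᶠ ℓ
    φ : Vector ℚ k → ℚ
    φ x = det k (x ∷ᶠ a ∷ᶠ ℓ)
    combination≡0 : ∀ r x → ((λ y → ∑[ i < suc k ] (cofactor W i * W i y)) ∷ᶠ a ∷ᶠ ℓ) r x ≡ ((λ _ → 0ℚ) ∷ᶠ a ∷ᶠ ℓ) r x
    combination≡0 zero    x = cofactor-relation k W x
    combination≡0 (suc r) x = refl
    without₁ : ∀ r x → W (punchIn (suc zero) r) x ≡ (b ∷ᶠ d ∷ᶠ ℓ) r x
    without₁ zero    x = refl
    without₁ (suc r) x = refl
    without₂ : ∀ r x → W (punchIn (suc (suc zero)) r) x ≡ (b ∷ᶠ c ∷ᶠ ℓ) r x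
    without₂ zero          x = refl
    without₂ (suc zero)    x = refl
    without₂ (suc (suc r)) x = refl
    cofactor₁ : cofactor W (suc zero) ≡ - Δ b d
    cofactor₁ = trans (cong (- 1ℚ *_) (det-cong k without₁)) (-1*x≈-x (Δ b d))
    cofactor₂ : cofactor W (suc (suc zero)) ≡ Δ b c
    cofactor₂ = trans (cong (1ℚ *_) (det-cong k without₂)) (ℚ.*-identityˡ (Δ b c))
    φ-ℓ : ∀ i → cofactor W (suc (suc (suc i))) * φ (ℓ i) ≡ 0ℚ
    φ-ℓ i = trans (cong (cofactor W (suc (suc (suc i))) *_) (det-equalRows₀ (suc m) (ℓ i ∷ᶠ a ∷ᶠ ℓ) (suc i) (λ _ → refl)))
                  (ℚ.*-zeroʳ (cofactor W (suc (suc (suc i)))))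
    expansion : ∑[ i < suc k ] (cofactor W i * φ (W i))
              ≡ 1ℚ * Δ c d * (- Δ a b) + ((- Δ b d) * (- Δ a c) + (Δ b c * (- Δ a d) + 0ℚ))
    expansion =
      cong₂ _+_ (cong (1ℚ * Δ c d *_) (det-∷-swap m b a ℓ))
        (cong₂ _+_ (cong₂ _*_ cofactor₁ (det-∷-swap m c a ℓ))
          (cong₂ _+_ (cong₂ _*_ cofactor₂ (det-∷-swap m d a ℓ))
            (trans (sum-cong-≗ φ-ℓ) (sum-replicate-zero m))))

  -- Missing rows are zero and surplus rows are ignored, hence the length hypotheses below.
  rows : ∀ {m k} → List (Vector ℚ k) → Fin m → Vector ℚ k
  rows []      _       = const 0ℚ
  rows (v ∷ ℓ) zero    = v
  rows (v ∷ ℓ) (suc r) = rows ℓ r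

  detRows : ∀ m → List (Vector ℚ m) → ℚ
  detRows m ℓ = det m (rows ℓ)

  rows₂ : ∀ {m k} (u v : Vector ℚ k) (ℓ : List (Vector ℚ k)) (r : Fin (suc (suc m))) c →
    rows (u ∷ v ∷ ℓ) r c ≡ (u ∷ᶠ v ∷ᶠ rows ℓ) r c
  rows₂ u v ℓ zero          c = refl
  rows₂ u v ℓ (suc zero)    c = refl
  rows₂ u v ℓ (suc (suc r)) c = refl

  rows-map-∘ : ∀ {m k k′} (h : Fin k′ → Fin k) (ℓ : List (Vector ℚ k)) (r : Fin m) c →
    rows (map (_∘ h) ℓ) r c ≡ rows ℓ r (h c)
  rows-map-∘ h []      r       c = refl
  rows-map-∘ h (v ∷ ℓ) zero    c = refl
  rows-map-∘ h (v ∷ ℓ) (suc r) c = rows-map-∘ h ℓ r c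

  detRows-∷ : ∀ m (x : Vector ℚ (suc m)) ℓ →
    detRows (suc m) (x ∷ ℓ) ≡ ∑[ j < suc m ] (altSign (toℕ j) * (x j * detRows m (map (_∘ punchIn j) ℓ)))
  detRows-∷ m x ℓ = trans (det-expand m (rows (x ∷ ℓ))) (sum-cong-≗ λ j →
    cong (λ D → altSign (toℕ j) * (x j * D)) (det-cong m (λ r c → sym (rows-map-∘ (punchIn j) ℓ r c))))

  detRows-∷-neg : ∀ m (x : Vector ℚ (suc m)) ℓ ℓ′ →
    (∀ j → detRows m (map (_∘ punchIn j) ℓ) ≡ - detRows m (map (_∘ punchIn j) ℓ′)) →
    detRows (suc m) (x ∷ ℓ) ≡ - detRows (suc m) (x ∷ ℓ′)
  detRows-∷-neg m x ℓ ℓ′ minors = begin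
    detRows (suc m) (x ∷ ℓ)                    ≡⟨ detRows-∷ m x ℓ ⟩
    ∑[ j < suc m ] (altSign (toℕ j) * (x j * detRows m (map (_∘ punchIn j) ℓ)))
      ≡⟨ sum-cong-≗ (λ j → trans (cong (λ D → altSign (toℕ j) * (x j * D)) (minors j))
                                 (solve 3 (λ s a d → s :* (a :* :- d) := :- (s :* (a :* d))) refl
                                    (altSign (toℕ j)) (x j) (detRows m (map (_∘ punchIn j) ℓ′)))) ⟩
    ∑[ j < suc m ] (- (altSign (toℕ j) * (x j * detRows m (map (_∘ punchIn j) ℓ′))))
      ≡⟨ neg-sum (λ j → altSign (toℕ j) * (x j * detRows m (map (_∘ punchIn j) ℓ′))) ⟨
    - ∑[ j < suc m ] (altSign (toℕ j) * (x j * detRows m (map (_∘ punchIn j) ℓ′)))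
      ≡⟨ cong -_ (detRows-∷ m x ℓ′) ⟨
    - detRows (suc m) (x ∷ ℓ′)                 ∎
    where open ≡-Reasoning

  detRows-swap : ∀ {m} pre (u v : Vector ℚ m) suf → length (pre ++ u ∷ v ∷ suf) ≡ m →
    detRows m (pre ++ u ∷ v ∷ suf) ≡ - detRows m (pre ++ v ∷ u ∷ suf)
  detRows-swap {zero}          []        u v suf ()
  detRows-swap {suc zero}      []        u v suf ()
  detRows-swap {zero}          (x ∷ pre) u v suf ()
  detRows-swap {suc (suc m)}   []        u v suf _ = begin
    det _ (rows (u ∷ v ∷ suf))       ≡⟨ det-cong _ (rows₂ u v suf) ⟩
    det _ (u ∷ᶠ v ∷ᶠ rows suf)       ≡⟨ det-∷-swap _ u v (rows suf) ⟩
    - det _ (v ∷ᶠ u ∷ᶠ rows suf)     ≡⟨ cong -_ (det-cong _ (rows₂ v u suf)) ⟨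
    - det _ (rows (v ∷ u ∷ suf))     ∎
    where open ≡-Reasoning
  detRows-swap {suc m}         (x ∷ pre) u v suf len =
    detRows-∷-neg m x (pre ++ u ∷ v ∷ suf) (pre ++ v ∷ u ∷ suf) λ j → begin
    detRows _ (map (_∘ punchIn j) (pre ++ u ∷ v ∷ suf))
      ≡⟨ cong (detRows _) (map-++ (_∘ punchIn j) pre (u ∷ v ∷ suf)) ⟩
    detRows _ (map (_∘ punchIn j) pre ++ u ∘ punchIn j ∷ v ∘ punchIn j ∷ map (_∘ punchIn j) suf)
      ≡⟨ detRows-swap (map (_∘ punchIn j) pre) (u ∘ punchIn j) (v ∘ punchIn j) (map (_∘ punchIn j) suf)
           (trans (sym (cong length (map-++ (_∘ punchIn j) pre (u ∷ v ∷ suf))))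
                  (trans (length-map (_∘ punchIn j) (pre ++ u ∷ v ∷ suf)) (ℕ.suc-injective len))) ⟩
    - detRows _ (map (_∘ punchIn j) pre ++ v ∘ punchIn j ∷ u ∘ punchIn j ∷ map (_∘ punchIn j) suf)
      ≡⟨ cong (-_ ∘ detRows _) (map-++ (_∘ punchIn j) pre (v ∷ u ∷ suf)) ⟨
    - detRows _ (map (_∘ punchIn j) (pre ++ v ∷ u ∷ suf)) ∎
    where open ≡-Reasoning

  detRows-move : ∀ {m} pre ys (z : Vector ℚ m) suf → length (pre ++ z ∷ ys ++ suf) ≡ m →
    detRows m (pre ++ ys ++ z ∷ suf) ≡ altSign (length ys) * detRows m (pre ++ z ∷ ys ++ suf)
  detRows-move pre []       z suf _   = sym (ℚ.*-identityˡ _)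
  detRows-move {m} pre (y ∷ ys) z suf len = begin
    detRows m (pre ++ y ∷ ys ++ z ∷ suf)
      ≡⟨ cong (detRows m) (++-assoc pre [ y ] (ys ++ z ∷ suf)) ⟨
    detRows m ((pre ++ [ y ]) ++ ys ++ z ∷ suf)
      ≡⟨ detRows-move (pre ++ [ y ]) ys z suf (trans (cong length (++-assoc pre [ y ] (z ∷ ys ++ suf))) len′) ⟩
    altSign (length ys) * detRows m ((pre ++ [ y ]) ++ z ∷ ys ++ suf)
      ≡⟨ cong (λ ℓ → altSign (length ys) * detRows m ℓ) (++-assoc pre [ y ] (z ∷ ys ++ suf)) ⟩
    altSign (length ys) * detRows m (pre ++ y ∷ z ∷ ys ++ suf)
      ≡⟨ cong (altSign (length ys) *_) (detRows-swap pre y z (ys ++ suf) len′) ⟩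
    altSign (length ys) * - detRows m (pre ++ z ∷ y ∷ ys ++ suf)
      ≡⟨ solve 2 (λ s d → s :* (:- d) := (:- s) :* d) refl (altSign (length ys)) _ ⟩
    (- altSign (length ys)) * detRows m (pre ++ z ∷ y ∷ ys ++ suf)
      ≡⟨ cong (_* detRows m (pre ++ z ∷ y ∷ ys ++ suf)) (altSign-suc (length ys)) ⟨
    altSign (length (y ∷ ys)) * detRows m (pre ++ z ∷ y ∷ ys ++ suf) ∎
    where
    open ≡-Reasoning
    len′ : length (pre ++ y ∷ z ∷ ys ++ suf) ≡ m
    len′ = trans (↭-length (++⁺ˡ pre (↭.swap y z ↭.refl))) len

  countBelow : ∀ {n} → Subset n → Fin n → ℕ
  countBelow (_       ∷ X) zero    = 0
  countBelow (inside  ∷ X) (suc z) = suc (countBelow X z)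
  countBelow (outside ∷ X) (suc z) = countBelow X z

  map-split : ∀ {A B : Set} (f : A → B) ys zs {xs} → xs ≡ ys ++ zs → map f xs ≡ map f ys ++ map f zs
  map-split f ys zs refl = map-++ f ys zs

  record Insertion {n} (X : Subset n) (z : Fin n) : Set where
    field
      before after  : List (Fin n)
      elems≡        : elems X ≡ before ++ after
      elems-∪≡      : elems (X ∪ ⁅ z ⁆) ≡ before ++ z ∷ after
      length-before : length before ≡ countBelow X z

  insertion : ∀ {n} (X : Subset n) (z : Fin n) → z ∉ X → Insertion X z
  insertion (inside  ∷ X) zero    z∉X = ⊥-elim (z∉X here)
  insertion (outside ∷ X) zero    _   = record
    { before = [] ; after = map suc (elems X) ; elems≡ = refl
    ; elems-∪≡ = cong (λ Y → zero ∷ map suc (elems Y)) (∪-identityʳ X) ; length-before = refl }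
  insertion (inside  ∷ X) (suc z) z∉X = record
    { before = zero ∷ map suc before ; after = map suc after
    ; elems≡ = cong (zero ∷_) (map-split suc before after elems≡)
    ; elems-∪≡ = cong (zero ∷_) (map-split suc before (z ∷ after) elems-∪≡)
    ; length-before = cong suc (trans (length-map suc before) length-before) }
    where open Insertion (insertion X z (z∉X ∘ there))
  insertion (outside ∷ X) (suc z) z∉X = record
    { before = map suc before ; after = map suc after
    ; elems≡ = map-split suc before after elems≡
    ; elems-∪≡ = map-split suc before (z ∷ after) elems-∪≡
    ; length-before = trans (length-map suc before) length-before }
    where open Insertion (insertion X z (z∉X ∘ there))

  length-elems : ∀ {n} (X : Subset n) → length (elems X) ≡ ∣ X ∣
  length-elems []            = refl
  length-elems (inside  ∷ X) = cong suc (trans (length-map suc (elems X)) (length-elems X))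
  length-elems (outside ∷ X) = trans (length-map suc (elems X)) (length-elems X)

  length-elems-∪⁅⁆ : ∀ {n} (X : Subset n) z → z ∉ X → length (elems (X ∪ ⁅ z ⁆)) ≡ suc ∣ X ∣
  length-elems-∪⁅⁆ X z z∉X = begin
    length (elems (X ∪ ⁅ z ⁆))       ≡⟨ cong length elems-∪≡ ⟩
    length (before ++ z ∷ after)     ≡⟨ length-++-sucʳ before z after ⟩
    suc (length (before ++ after))   ≡⟨ cong (suc ∘ length) elems≡ ⟨
    suc (length (elems X))           ≡⟨ cong suc (length-elems X) ⟩
    suc ∣ X ∣                        ∎
    where
    open ≡-Reasoning
    open Insertion (insertion X z z∉X)

  ∣∪⁅⁆∣ : ∀ {n} (X : Subset n) z → z ∉ X → ∣ X ∪ ⁅ z ⁆ ∣ ≡ suc ∣ X ∣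
  ∣∪⁅⁆∣ X z z∉X = trans (sym (length-elems (X ∪ ⁅ z ⁆))) (length-elems-∪⁅⁆ X z z∉X)

  ∉-∪⁅⁆ : ∀ {n} {L : Subset n} {x y} → y ∉ L → y ≢ x → y ∉ L ∪ ⁅ x ⁆
  ∉-∪⁅⁆ {L = L} {x} y∉L y≢x y∈ with x∈p∪q⁻ L ⁅ x ⁆ y∈
  ... | inj₁ y∈L  = y∉L y∈L
  ... | inj₂ y∈⁅x⁆ = y≢x (x∈⁅y⁆⇒x≡y x y∈⁅x⁆)

  countBelow-∪⁅⁆ : ∀ {n} (L : Subset n) x y → x ∉ L → x < y → countBelow (L ∪ ⁅ x ⁆) y ≡ suc (countBelow L y)
  countBelow-∪⁅⁆ (inside  ∷ L) zero    y       x∉L _         = ⊥-elim (x∉L here)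
  countBelow-∪⁅⁆ (outside ∷ L) zero    (suc y) _   _         = cong (λ Y → suc (countBelow Y y)) (∪-identityʳ L)
  countBelow-∪⁅⁆ (inside  ∷ L) (suc x) (suc y) x∉L (s≤s x<y) = cong suc (countBelow-∪⁅⁆ L x y (x∉L ∘ there) x<y)
  countBelow-∪⁅⁆ (outside ∷ L) (suc x) (suc y) x∉L (s≤s x<y) = countBelow-∪⁅⁆ L x y (x∉L ∘ there) x<y

  ∣∪₂∣ : ∀ {n} (L : Subset n) {x y} → x ∉ L → y ∉ L → x < y → ∣ L ∪₂ (x , y) ∣ ≡ suc (suc ∣ L ∣)
  ∣∪₂∣ L {x} {y} x∉L y∉L x<y =
    trans (∣∪⁅⁆∣ (L ∪ ⁅ x ⁆) y (∉-∪⁅⁆ y∉L (Fin.<⇒≢ x<y ∘ sym))) (cong suc (∣∪⁅⁆∣ L x x∉L))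

  detRows-insert : ∀ {m n} (col : Fin n → Vector ℚ m) pre (X : Subset n) z → z ∉ X →
    length (pre ++ col z ∷ map col (elems X)) ≡ m →
    detRows m (pre ++ map col (elems (X ∪ ⁅ z ⁆))) ≡ altSign (countBelow X z) * detRows m (pre ++ col z ∷ map col (elems X))
  detRows-insert {m} col pre X z z∉X len = begin
    detRows m (pre ++ map col (elems (X ∪ ⁅ z ⁆)))
      ≡⟨ cong (λ ℓ → detRows m (pre ++ ℓ)) (map-split col before (z ∷ after) elems-∪≡) ⟩
    detRows m (pre ++ map col before ++ col z ∷ map col after)
      ≡⟨ detRows-move pre (map col before) (col z) (map col after)
           (trans (cong (λ ℓ → length (pre ++ col z ∷ ℓ)) cols≡) len) ⟩
    altSign (length (map col before)) * detRows m (pre ++ col z ∷ map col before ++ map col after)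
      ≡⟨ cong₂ (λ i ℓ → altSign i * detRows m (pre ++ col z ∷ ℓ))
               (trans (length-map col before) length-before) cols≡ ⟩
    altSign (countBelow X z) * detRows m (pre ++ col z ∷ map col (elems X)) ∎
    where
    open ≡-Reasoning
    open Insertion (insertion X z z∉X)
    cols≡ : map col before ++ map col after ≡ map col (elems X)
    cols≡ = sym (map-split col before after elems≡)

  detRows-insert₂ : ∀ {m n} (col : Fin n → Vector ℚ m) (L : Subset n) {x y} → x ∉ L → y ∉ L → x < y →
    suc (suc ∣ L ∣) ≡ m →
    detRows m (map col (elems (L ∪₂ (x , y))))
      ≡ altSign (countBelow L x) * altSign (countBelow L y) * detRows m (col x ∷ col y ∷ map col (elems L))
  detRows-insert₂ {m} {n} col L {x} {y} x∉L y∉L x<y |L|+2≡m = begin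
    detRows m (map col (elems ((L ∪ ⁅ x ⁆) ∪ ⁅ y ⁆)))
      ≡⟨ detRows-insert col [] (L ∪ ⁅ x ⁆) y (∉-∪⁅⁆ y∉L (Fin.<⇒≢ x<y ∘ sym)) length₁ ⟩
    σ′ * detRows m (col y ∷ map col (elems (L ∪ ⁅ x ⁆)))
      ≡⟨ cong (σ′ *_) (detRows-insert col [ col y ] L x x∉L length₂) ⟩
    σ′ * (σ x * detRows m (col y ∷ col x ∷ map col (elems L)))
      ≡⟨ cong (λ D → σ′ * (σ x * D)) (detRows-swap [] (col y) (col x) (map col (elems L)) length₂) ⟩
    σ′ * (σ x * - D)
      ≡⟨ cong (λ s → s * (σ x * - D)) (trans (cong altSign (countBelow-∪⁅⁆ L x y x∉L x<y)) (altSign-suc (countBelow L y))) ⟩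
    (- σ y) * (σ x * - D)
      ≡⟨ solve 3 (λ sy sx d → (:- sy) :* (sx :* (:- d)) := sx :* sy :* d) refl (σ y) (σ x) D ⟩
    σ x * σ y * D ∎
    where
    open ≡-Reasoning
    σ : Fin n → ℚ
    σ z = altSign (countBelow L z)
    σ′ = altSign (countBelow (L ∪ ⁅ x ⁆) y)
    D = detRows m (col x ∷ col y ∷ map col (elems L))
    length₁ : length (col y ∷ map col (elems (L ∪ ⁅ x ⁆))) ≡ m
    length₁ = trans (cong suc (trans (length-map col (elems (L ∪ ⁅ x ⁆))) (length-elems-∪⁅⁆ L x x∉L))) |L|+2≡m
    length₂ : length (col y ∷ col x ∷ map col (elems L)) ≡ m
    length₂ = trans (cong (λ (l : ℕ) → suc (suc l)) (trans (length-map col (elems L)) (length-elems L))) |L|+2≡m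

  column : ∀ {k n} → (Fin k → Fin n → ℚ) → Fin n → Vector ℚ k
  column g i r = g r i

  subMatrix-rows : ∀ {m k n} (g : Fin k → Fin n → ℚ) (ℓ : List (Fin n)) (j : Fin m) r →
    maybe (g r) 0ℚ (nth ℓ (toℕ j)) ≡ rows (map (column g) ℓ) j r
  subMatrix-rows g []      j       r = refl
  subMatrix-rows g (i ∷ ℓ) zero    r = refl
  subMatrix-rows g (i ∷ ℓ) (suc j) r = subMatrix-rows g ℓ j r

  plucker≡detRows : ∀ {k n} (g : Fin k → Fin n → ℚ) (I : Subset n) →
    plucker g I ≡ detRows k (map (column g) (elems I))
  plucker≡detRows {k} g I =
    trans (sym (det-transpose k (subMatrix g I))) (det-cong k (subMatrix-rows g (elems I)))

  plücker-relation : ∀ {k n} (g : Fin k → Fin n → ℚ) (L : Subset n) {a b c d} →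
    a < b → b < c → c < d → a ∉ L → b ∉ L → c ∉ L → d ∉ L → suc (suc ∣ L ∣) ≡ k →
    let P x y = plucker g (L ∪₂ (x , y)) in
    P a b * P c d + (- (P a c * P b d) + P a d * P b c) ≡ 0ℚ
  plücker-relation g L {a} {b} {c} {d} a<b b<c c<d a∉L b∉L c∉L d∉L refl = begin
    P a b * P c d + (- (P a c * P b d) + P a d * P b c)
      ≡⟨ cong₂ _+_ (cong₂ _*_ (P≡ a∉L b∉L a<b) (P≡ c∉L d∉L c<d))
                   (cong₂ _+_ (cong -_ (cong₂ _*_ (P≡ a∉L c∉L a<c) (P≡ b∉L d∉L b<d)))
                              (cong₂ _*_ (P≡ a∉L d∉L a<d) (P≡ b∉L c∉L b<c))) ⟩
    σ a * σ b * Δ a b * (σ c * σ d * Δ c d)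
      + (- (σ a * σ c * Δ a c * (σ b * σ d * Δ b d)) + σ a * σ d * Δ a d * (σ b * σ c * Δ b c))
      ≡⟨ solve 10 (λ sa sb sc sd ab cd ac bd ad bc →
             sa :* sb :* ab :* (sc :* sd :* cd) :+ (:- (sa :* sc :* ac :* (sb :* sd :* bd)) :+ sa :* sd :* ad :* (sb :* sc :* bc))
             := (sa :* sb :* sc :* sd) :* (ab :* cd :+ (:- (ac :* bd) :+ ad :* bc)))
           refl (σ a) (σ b) (σ c) (σ d) (Δ a b) (Δ c d) (Δ a c) (Δ b d) (Δ a d) (Δ b c) ⟩
    σ a * σ b * σ c * σ d * (Δ a b * Δ c d + (- (Δ a c * Δ b d) + Δ a d * Δ b c))
      ≡⟨ cong (σ a * σ b * σ c * σ d *_) (det-plücker ∣ L ∣ ℓ (col a) (col b) (col c) (col d)) ⟩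
    σ a * σ b * σ c * σ d * 0ℚ
      ≡⟨ ℚ.*-zeroʳ (σ a * σ b * σ c * σ d) ⟩
    0ℚ ∎
    where
    open ≡-Reasoning
    P : Fin _ → Fin _ → ℚ
    P x y = plucker g (L ∪₂ (x , y))
    col = column g
    ℓ = rows (map col (elems L))
    Δ : Fin _ → Fin _ → ℚ
    Δ x y = det _ (col x ∷ᶠ col y ∷ᶠ ℓ)
    σ : Fin _ → ℚ
    σ z = altSign (countBelow L z)
    a<c = ℕ.<-trans a<b b<c
    b<d = ℕ.<-trans b<c c<d
    a<d = ℕ.<-trans a<c c<d
    P≡ : ∀ {x y} → x ∉ L → y ∉ L → x < y → P x y ≡ σ x * σ y * Δ x y
    P≡ {x} {y} x∉L y∉L x<y = begin
      P x y                                                       ≡⟨ plucker≡detRows g (L ∪₂ (x , y)) ⟩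
      detRows _ (map col (elems (L ∪₂ (x , y))))                  ≡⟨ detRows-insert₂ col L x∉L y∉L x<y refl ⟩
      σ x * σ y * detRows _ (col x ∷ col y ∷ map col (elems L))   ≡⟨ cong (σ x * σ y *_) (det-cong _ (rows₂ (col x) (col y) (map col (elems L)))) ⟩
      σ x * σ y * Δ x y                                           ∎

  hasSign-* : ∀ s t {x y} → HasSign s x → HasSign t y → HasSign (s · t) (x * y)
  hasSign-* Sign.+ Sign.+ {x} {y} 0<x 0<y = ℚ.positive⁻¹ (x * y) {{ℚ.pos*pos⇒pos x {{positive 0<x}} y {{positive 0<y}}}}
  hasSign-* Sign.+ Sign.- {x} {y} 0<x y<0 = ℚ.negative⁻¹ (x * y) {{ℚ.pos*neg⇒neg x {{positive 0<x}} y {{negative y<0}}}}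
  hasSign-* Sign.- Sign.+ {x} {y} x<0 0<y = ℚ.negative⁻¹ (x * y) {{ℚ.neg*pos⇒neg x {{negative x<0}} y {{positive 0<y}}}}
  hasSign-* Sign.- Sign.- {x} {y} x<0 y<0 = ℚ.positive⁻¹ (x * y) {{ℚ.neg*neg⇒pos x {{negative x<0}} y {{negative y<0}}}}

  hasSign-neg : ∀ s {x} → HasSign s x → HasSign (opposite s) (- x)
  hasSign-neg Sign.+ 0<x = ℚ.neg-antimono-< 0<x
  hasSign-neg Sign.- x<0 = ℚ.neg-antimono-< x<0

  signs-not-all-equal : ∀ s₀ s₁ s₂ {u₀ u₁ u₂} → HasSign s₀ u₀ → HasSign s₁ u₁ → HasSign s₂ u₂ →
    u₀ + (u₁ + u₂) ≡ 0ℚ → ¬ (s₀ ≡ s₁ × s₁ ≡ s₂)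
  signs-not-all-equal Sign.+ _ _ h₀ h₁ h₂ sum≡0 (refl , refl) =
    ℚ.<-irrefl (sym sum≡0) (ℚ.+-mono-< h₀ (ℚ.+-mono-< h₁ h₂))
  signs-not-all-equal Sign.- _ _ h₀ h₁ h₂ sum≡0 (refl , refl) =
    ℚ.<-irrefl sum≡0 (ℚ.+-mono-< h₀ (ℚ.+-mono-< h₁ h₂))

  oddAt : Fin 3 → Sign → Fin 3 → Sign
  oddAt s σ t = if does (t Fin.≟ s) then σ else opposite σ

  ≗-by-cases₃ : ∀ {A : Set} {f g : Fin 3 → A} →
    f zero ≡ g zero → f (suc zero) ≡ g (suc zero) → f (suc (suc zero)) ≡ g (suc (suc zero)) → ∀ t → f t ≡ g t
  ≗-by-cases₃ e₀ e₁ e₂ zero             = e₀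
  ≗-by-cases₃ e₀ e₁ e₂ (suc zero)       = e₁
  ≗-by-cases₃ e₀ e₁ e₂ (suc (suc zero)) = e₂

  oddOneOut : ∀ (τ : Fin 3 → Sign) → ¬ (τ zero ≡ τ (suc zero) × τ (suc zero) ≡ τ (suc (suc zero))) →
    ∃₂ λ s σ → ∀ t → τ t ≡ oddAt s σ t
  oddOneOut τ notAllEqual with τ zero in e₀ | τ (suc zero) in e₁ | τ (suc (suc zero)) in e₂
  ... | Sign.+ | Sign.+ | Sign.+ = ⊥-elim (notAllEqual (refl , refl))
  ... | Sign.- | Sign.- | Sign.- = ⊥-elim (notAllEqual (refl , refl))
  ... | Sign.+ | Sign.+ | Sign.- = suc (suc zero) , Sign.- , ≗-by-cases₃ e₀ e₁ e₂
  ... | Sign.- | Sign.- | Sign.+ = suc (suc zero) , Sign.+ , ≗-by-cases₃ e₀ e₁ e₂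
  ... | Sign.+ | Sign.- | Sign.+ = suc zero , Sign.- , ≗-by-cases₃ e₀ e₁ e₂
  ... | Sign.- | Sign.+ | Sign.- = suc zero , Sign.+ , ≗-by-cases₃ e₀ e₁ e₂
  ... | Sign.- | Sign.+ | Sign.+ = zero , Sign.- , ≗-by-cases₃ e₀ e₁ e₂
  ... | Sign.+ | Sign.- | Sign.- = zero , Sign.+ , ≗-by-cases₃ e₀ e₁ e₂

  other₁ other₂ : Fin 3 → Fin 3
  other₁ zero             = suc zero
  other₁ (suc zero)       = zero
  other₁ (suc (suc zero)) = zero
  other₂ zero             = suc (suc zero)
  other₂ (suc zero)       = suc (suc zero)
  other₂ (suc (suc zero)) = suc zero

  minOthers : Fin 3 → (Fin 3 → ℚ) → ℚ
  minOthers s w = w (other₁ s) ⊓ w (other₂ s)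

  IsSplitAt : Fin 3 → (Fin 3 → ℚ) → Set
  IsSplitAt t w = w (other₁ t) ≡ w (other₂ t) × w (other₁ t) <ℚ w t

  isSplitAt : ∀ t (w : Fin 3 → ℚ) i j → i ≢ j → i ≢ t → j ≢ t → w i ≡ w j → w i <ℚ w t → IsSplitAt t w
  isSplitAt zero             w (suc zero)       (suc (suc zero)) _ _ _ e lt = e , lt
  isSplitAt zero             w (suc (suc zero)) (suc zero)       _ _ _ e lt = sym e , subst (_<ℚ w zero) e lt
  isSplitAt (suc zero)       w zero             (suc (suc zero)) _ _ _ e lt = e , lt
  isSplitAt (suc zero)       w (suc (suc zero)) zero             _ _ _ e lt = sym e , subst (_<ℚ w (suc zero)) e lt
  isSplitAt (suc (suc zero)) w zero             (suc zero)       _ _ _ e lt = e , lt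
  isSplitAt (suc (suc zero)) w (suc zero)       zero             _ _ _ e lt = sym e , subst (_<ℚ w (suc (suc zero))) e lt
  isSplitAt zero             w zero             _                _ i≢t _ _ _ = ⊥-elim (i≢t refl)
  isSplitAt (suc zero)       w (suc zero)       _                _ i≢t _ _ _ = ⊥-elim (i≢t refl)
  isSplitAt (suc (suc zero)) w (suc (suc zero)) _                _ i≢t _ _ _ = ⊥-elim (i≢t refl)
  isSplitAt zero             w _                zero             _ _ j≢t _ _ = ⊥-elim (j≢t refl)
  isSplitAt (suc zero)       w _                (suc zero)       _ _ j≢t _ _ = ⊥-elim (j≢t refl)
  isSplitAt (suc (suc zero)) w _                (suc (suc zero)) _ _ j≢t _ _ = ⊥-elim (j≢t refl)
  isSplitAt _                w (suc zero)       (suc zero)       i≢j _ _ _ _ = ⊥-elim (i≢j refl)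
  isSplitAt _                w (suc (suc zero)) (suc (suc zero)) i≢j _ _ _ _ = ⊥-elim (i≢j refl)
  isSplitAt _                w zero             zero             i≢j _ _ _ _ = ⊥-elim (i≢j refl)

  minOthers<self : ∀ s w → IsSplitAt s w → minOthers s w <ℚ w s
  minOthers<self s w (e , lt) = subst (_<ℚ w s) (sym (trans (cong (w (other₁ s) ⊓_) (sym e)) (ℚ.⊓-idem _))) lt

  minOthers≡self : ∀ s t w → IsSplitAt t w → t ≢ s → w s ≡ minOthers s w
  minOthers≡self zero             (suc zero)       w (e , lt) _ = trans e (sym (ℚ.p≥q⇒p⊓q≡q (ℚ.<⇒≤ (subst (_<ℚ w (suc zero)) e lt))))
  minOthers≡self zero             (suc (suc zero)) w (e , lt) _ = trans e (sym (ℚ.p≤q⇒p⊓q≡p (ℚ.<⇒≤ (subst (_<ℚ w (suc (suc zero))) e lt))))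
  minOthers≡self (suc zero)       zero             w (e , lt) _ = trans e (sym (ℚ.p≥q⇒p⊓q≡q (ℚ.<⇒≤ (subst (_<ℚ w zero) e lt))))
  minOthers≡self (suc zero)       (suc (suc zero)) w (e , lt) _ = trans (sym e) (sym (ℚ.p≤q⇒p⊓q≡p (ℚ.<⇒≤ lt)))
  minOthers≡self (suc (suc zero)) zero             w (e , lt) _ = trans (sym e) (sym (ℚ.p≥q⇒p⊓q≡q (ℚ.<⇒≤ lt)))
  minOthers≡self (suc (suc zero)) (suc zero)       w (e , lt) _ = trans (sym e) (sym (ℚ.p≤q⇒p⊓q≡p (ℚ.<⇒≤ lt)))
  minOthers≡self zero             zero             w _ t≢s = ⊥-elim (t≢s refl)
  minOthers≡self (suc zero)       (suc zero)       w _ t≢s = ⊥-elim (t≢s refl)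
  minOthers≡self (suc (suc zero)) (suc (suc zero)) w _ t≢s = ⊥-elim (t≢s refl)

  select : Sign → Sign → ℚ → Maybe ℚ
  select Sign.+ Sign.+ w = just w
  select Sign.- Sign.- w = just w
  select Sign.+ Sign.- w = nothing
  select Sign.- Sign.+ w = nothing

  select-self : ∀ s w → select s s w ≡ just w
  select-self Sign.+ w = refl
  select-self Sign.- w = refl

  select-≢ : ∀ {s σ} w → s ≢ σ → select s σ w ≡ nothing
  select-≢ {Sign.+} {Sign.+} w s≢σ = ⊥-elim (s≢σ refl)
  select-≢ {Sign.-} {Sign.-} w s≢σ = ⊥-elim (s≢σ refl)
  select-≢ {Sign.+} {Sign.-} w _   = refl
  select-≢ {Sign.-} {Sign.+} w _   = refl

  module _ {n} (L : Subset n) (a b c d : Fin n) where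
    open ThreeTerm L a b c d

    tropOf : (Fin 3 → Sign) → Sign → (Fin 3 → ℚ) → Maybe ℚ
    tropOf τ σ w = minM (select (τ zero) σ (w zero))
                     (minM (select (τ (suc zero)) σ (w (suc zero))) (select (τ (suc (suc zero))) σ (w (suc (suc zero)))))

    contrib≡select : ∀ χ σ π t → contrib χ σ π t ≡ select (termSign χ t) σ (weight π t)
    contrib≡select χ σ π t with termSign χ t ≟ˢ σ
    ... | yes refl = sym (select-self (termSign χ t) (weight π t))
    ... | no  s≢σ  = sym (select-≢ (weight π t) s≢σ)

    tropPart≡tropOf : ∀ χ {τ} → (∀ t → termSign χ t ≡ τ t) → ∀ σ π → tropPart χ σ π ≡ tropOf τ σ (weight π)
    tropPart≡tropOf χ {τ} τ≗ σ π =
      cong₂ minM (selected zero) (cong₂ minM (selected (suc zero)) (selected (suc (suc zero))))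
      where
      selected : ∀ t → contrib χ σ π t ≡ select (τ t) σ (weight π t)
      selected t = trans (contrib≡select χ σ π t) (cong (λ s → select s σ (weight π t)) (τ≗ t))

    tropOf-oddAt : ∀ s σ w → tropOf (oddAt s σ) σ w ≡ just (w s) × tropOf (oddAt s σ) (opposite σ) w ≡ just (minOthers s w)
    tropOf-oddAt zero             Sign.+ w = refl , refl
    tropOf-oddAt zero             Sign.- w = refl , refl
    tropOf-oddAt (suc zero)       Sign.+ w = refl , refl
    tropOf-oddAt (suc zero)       Sign.- w = refl , refl
    tropOf-oddAt (suc (suc zero)) Sign.+ w = refl , refl
    tropOf-oddAt (suc (suc zero)) Sign.- w = refl , refl

    balanced⇔ : ∀ s σ w → (tropOf (oddAt s σ) Sign.+ w ≡ tropOf (oddAt s σ) Sign.- w) ⇔ (w s ≡ minOthers s w)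
    balanced⇔ s Sign.+ w with tropOf-oddAt s Sign.+ w
    ... | e₊ , e₋ rewrite e₊ | e₋ = mk⇔ just-injective (cong just)
    balanced⇔ s Sign.- w with tropOf-oddAt s Sign.- w
    ... | e₋ , e₊ rewrite e₊ | e₋ = mk⇔ (sym ∘ just-injective) (cong just ∘ sym)

    inducesSplit⇒isSplitAt : ∀ t π → InducesSplit t π → IsSplitAt t (weight π)
    inducesSplit⇒isSplitAt t π (i , j , i≢j , i≢t , j≢t , e , lt) = isSplitAt t (weight π) i j i≢j i≢t j≢t e lt

    exactlyTwoCompatible : ∀ χ → (∀ s → Σ _ (InducesSplit s)) →
      ¬ (termSign χ zero ≡ termSign χ (suc zero) × termSign χ (suc zero) ≡ termSign χ (suc (suc zero))) →
      ExactlyTwoCompatible χ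
    exactlyTwoCompatible χ splitWitness notAllEqual with oddOneOut (termSign χ) notAllEqual
    ... | s , σ , τ≗ = s , incompatible , compatible
      where
      trop : ∀ ρ π → tropPart χ ρ π ≡ tropOf (oddAt s σ) ρ (weight π)
      trop = tropPart≡tropOf χ τ≗
      incompatible : ¬ Compatible χ s
      incompatible balanced with splitWitness s
      ... | π , split = ℚ.<-irrefl
        (sym (Equivalence.to (balanced⇔ s σ (weight π))
          (trans (sym (trop Sign.+ π)) (trans (balanced π split) (trop Sign.- π)))))
        (minOthers<self s (weight π) (inducesSplit⇒isSplitAt s π split))
      compatible : ∀ t → t ≢ s → Compatible χ t
      compatible t t≢s π split = trans (trop Sign.+ π)
        (trans (Equivalence.from (balanced⇔ s σ (weight π)) (minOthers≡self s t (weight π) (inducesSplit⇒isSplitAt t π split) t≢s))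
               (sym (trop Sign.- π)))

  pairIndicator : ∀ {n} → Fin n → Fin n → Subset n → ℚ
  pairIndicator p q X = if does (p ∈? X) ∧ does (q ∈? X) then 1ℚ else 0ℚ

  pairIndicator-∈ : ∀ {n} (p q : Fin n) {X} → p ∈ X → q ∈ X → pairIndicator p q X ≡ 1ℚ
  pairIndicator-∈ p q {X} p∈X q∈X rewrite dec-true (p ∈? X) p∈X | dec-true (q ∈? X) q∈X = refl

  pairIndicator-∉ˡ : ∀ {n} (p q : Fin n) {X} → p ∉ X → pairIndicator p q X ≡ 0ℚ
  pairIndicator-∉ˡ p q {X} p∉X rewrite dec-false (p ∈? X) p∉X = refl

  pairIndicator-∉ʳ : ∀ {n} (p q : Fin n) {X} → q ∉ X → pairIndicator p q X ≡ 0ℚ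
  pairIndicator-∉ʳ p q {X} q∉X rewrite dec-false (q ∈? X) q∉X | ∧-zeroʳ (does (p ∈? X)) = refl

  ∈-∪₂ˡ : ∀ {n} (L : Subset n) x y → x ∈ L ∪₂ (x , y)
  ∈-∪₂ˡ L x y = x∈p∪q⁺ {p = L ∪ ⁅ x ⁆} {q = ⁅ y ⁆} (inj₁ (x∈p∪q⁺ {p = L} {q = ⁅ x ⁆} (inj₂ (x∈⁅x⁆ x))))

  ∈-∪₂ʳ : ∀ {n} (L : Subset n) x y → y ∈ L ∪₂ (x , y)
  ∈-∪₂ʳ L x y = x∈p∪q⁺ {p = L ∪ ⁅ x ⁆} {q = ⁅ y ⁆} (inj₂ (x∈⁅x⁆ y))

  ∉-∪₂ : ∀ {n} {L : Subset n} {x y z} → z ∉ L → z ≢ x → z ≢ y → z ∉ L ∪₂ (x , y)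
  ∉-∪₂ z∉L z≢x z≢y = ∉-∪⁅⁆ (∉-∪⁅⁆ z∉L z≢x) z≢y

  module _ {n} {L : Subset n} {a b c d : Fin n} (a<b : a < b) (b<c : b < c) (c<d : c < d)
           (a∉L : a ∉ L) (b∉L : b ∉ L) (c∉L : c ∉ L) (d∉L : d ∉ L) where
    open ThreeTerm L a b c d

    private
      a<c = ℕ.<-trans a<b b<c
      a<d = ℕ.<-trans a<c c<d
      b<d = ℕ.<-trans b<c c<d

    partner : Fin 3 → Fin n
    partner zero             = b
    partner (suc zero)       = c
    partner (suc (suc zero)) = d

    partner∉L : ∀ s → partner s ∉ L
    partner∉L zero             = b∉L
    partner∉L (suc zero)       = c∉L
    partner∉L (suc (suc zero)) = d∉L

    a<partner : ∀ s → a < partner s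
    a<partner zero             = a<b
    a<partner (suc zero)       = a<c
    a<partner (suc (suc zero)) = a<d

    partner-≢ : ∀ {s t} → s ≢ t → partner s ≢ partner t
    partner-≢ {zero}             {suc zero}       _ = Fin.<⇒≢ b<c
    partner-≢ {zero}             {suc (suc zero)} _ = Fin.<⇒≢ b<d
    partner-≢ {suc zero}         {zero}           _ = Fin.<⇒≢ b<c ∘ sym
    partner-≢ {suc zero}         {suc (suc zero)} _ = Fin.<⇒≢ c<d
    partner-≢ {suc (suc zero)}   {zero}           _ = Fin.<⇒≢ b<d ∘ sym
    partner-≢ {suc (suc zero)}   {suc zero}       _ = Fin.<⇒≢ c<d ∘ sym
    partner-≢ {zero}             {zero}           s≢t = ⊥-elim (s≢t refl)
    partner-≢ {suc zero}         {suc zero}       s≢t = ⊥-elim (s≢t refl)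
    partner-≢ {suc (suc zero)}   {suc (suc zero)} s≢t = ⊥-elim (s≢t refl)

    first≡ : ∀ t → proj₁ (termSets t) ≡ L ∪₂ (a , partner t)
    first≡ zero             = refl
    first≡ (suc zero)       = refl
    first≡ (suc (suc zero)) = refl

    a∉second : ∀ t → a ∉ proj₂ (termSets t)
    a∉second zero             = ∉-∪₂ a∉L (Fin.<⇒≢ a<c) (Fin.<⇒≢ a<d)
    a∉second (suc zero)       = ∉-∪₂ a∉L (Fin.<⇒≢ a<b) (Fin.<⇒≢ a<d)
    a∉second (suc (suc zero)) = ∉-∪₂ a∉L (Fin.<⇒≢ a<b) (Fin.<⇒≢ a<c)

    weight-self : ∀ s → weight (pairIndicator a (partner s)) s ≡ 1ℚ + 0ℚ
    weight-self s = cong₂ _+_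
      (trans (cong (pairIndicator a (partner s)) (first≡ s)) (pairIndicator-∈ a (partner s) (∈-∪₂ˡ L a (partner s)) (∈-∪₂ʳ L a (partner s))))
      (pairIndicator-∉ˡ a (partner s) (a∉second s))

    weight-other : ∀ s t → s ≢ t → weight (pairIndicator a (partner s)) t ≡ 0ℚ + 0ℚ
    weight-other s t s≢t = cong₂ _+_
      (trans (cong (pairIndicator a (partner s)) (first≡ t))
             (pairIndicator-∉ʳ a (partner s) (∉-∪₂ (partner∉L s) (Fin.<⇒≢ (a<partner s) ∘ sym) (partner-≢ s≢t))))
      (pairIndicator-∉ˡ a (partner s) (a∉second t))

    other₁≢ : ∀ s → other₁ s ≢ s
    other₁≢ zero             ()
    other₁≢ (suc zero)       ()
    other₁≢ (suc (suc zero)) ()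

    other₂≢ : ∀ s → other₂ s ≢ s
    other₂≢ zero             ()
    other₂≢ (suc zero)       ()
    other₂≢ (suc (suc zero)) ()

    other₁≢other₂ : ∀ s → other₁ s ≢ other₂ s
    other₁≢other₂ zero             ()
    other₁≢other₂ (suc zero)       ()
    other₁≢other₂ (suc (suc zero)) ()

    -- Of the six index sets, only the first one of term s contains both a and partner s.
    splitWitness : ∀ s → Σ _ (InducesSplit s)
    splitWitness s = pairIndicator a (partner s) , other₁ s , other₂ s ,
      other₁≢other₂ s , other₁≢ s , other₂≢ s ,
      trans (weight-other s (other₁ s) (other₁≢ s ∘ sym)) (sym (weight-other s (other₂ s) (other₂≢ s ∘ sym))) ,
      subst₂ _<ℚ_ (sym (weight-other s (other₁ s) (other₁≢ s ∘ sym))) (sym (weight-self s)) (ℚ.positive⁻¹ 1ℚ)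

open import Data.Fin using (Fin; _<_)
open import Data.Fin.Subset using (Subset; ∣_∣; _∉_)
open import Data.Nat using (ℕ; suc; _+_)
import Data.Nat.Properties as ℕ
open import Data.Product using (_,_)
open import Relation.Binary.PropositionalEquality using (_≡_; trans)

open ThreeTermRelation

lemma3p5 : (k n : ℕ) (χ : Chirotope n) → UniformRealizable k n χ →
    (L : Subset n) → ∣ L ∣ + 2 ≡ k →
    (a b c d : Fin n) → a < b → b < c → c < d →
    a ∉ L → b ∉ L → c ∉ L → d ∉ L →
    ThreeTerm.ExactlyTwoCompatible L a b c d χ
lemma3p5 k n χ (g , realizes) L |L|+2≡k a b c d a<b b<c c<d a∉L b∉L c∉L d∉L =
  exactlyTwoCompatible L a b c d χ (splitWitness a<b b<c c<d a∉L b∉L c∉L d∉L) notAllEqual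
  where
  open ThreeTerm L a b c d
  2+|L|≡k : suc (suc ∣ L ∣) ≡ k
  2+|L|≡k = trans (ℕ.+-comm 2 ∣ L ∣) |L|+2≡k
  realized : ∀ {x y} → x ∉ L → y ∉ L → x < y → HasSign (χ (L ∪₂ (x , y))) (plucker g (L ∪₂ (x , y)))
  realized x∉L y∉L x<y = realizes _ (trans (∣∪₂∣ L x∉L y∉L x<y) 2+|L|≡k)
  a<c = ℕ.<-trans a<b b<c
  b<d = ℕ.<-trans b<c c<d
  a<d = ℕ.<-trans a<c c<d
  notAllEqual = signs-not-all-equal _ _ _
    (hasSign-* _ _ (realized a∉L b∉L a<b) (realized c∉L d∉L c<d))
    (hasSign-neg _ (hasSign-* _ _ (realized a∉L c∉L a<c) (realized b∉L d∉L b<d)))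
    (hasSign-* _ _ (realized a∉L d∉L a<d) (realized b∉L c∉L b<c))
    (plücker-relation g L a<b b<c c<d a∉L b∉L c∉L d∉L 2+|L|≡k)
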